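{- For all $k$, $D_k(x_1,x_2)\le D_{k+1}(x_1,x_2)$. Here $k\ge 2$ is an integer and $x_1,x_2\ge 0$ satisfy $x_1+x_2\le 1$ (with $x_1+x_2=1$ when $k=2$, so that $D_k(x_1,x_2)$ is defined).
   Context: The $k$-simplex is $\{x\in\mathbb{R}^k: x\ge 0,\ \sum_i x_i=1\}$. Let $F(z)=\min\{(11/6)z,1\}$ for $z\in[0,1]$, and let $F'(z)=11/6$ for $z\in[0,6/11]$ and $F'(z)=0$ otherwise. For a point $(x_1,\dots,x_k)$ of the $k$-simplex define $$d_k(x_1,\ldots,x_k)=\frac{1}{k!}\sum_{\sigma}\Big(F'(x_1)\prod_{i:\sigma(i)<\sigma(1)}[1-F(x_i)]+F'(x_2)\prod_{i:\sigma(i)<\sigma(2)}[1-F(x_i)]\Big),$$ the sum being over all permutations $\sigma$ of $\{1,\dots,k\}$. Define $D_k(x_1,x_2)=\max_{x_3,\ldots,x_k}d_k(x_1,x_2,\ldots,x_k)$, the maximum being over all $x_3,\dots,x_k$ such that $(x_1,\dots,x_k)$ lies in the $k$-simplex. -}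

module Defs where

open import Algebra.Bundles using (CommutativeRing)
import Algebra.Construct.NaturalChoice.Min as Min
import Algebra.Definitions.RawMonoid as RawMonoidOps
open import Data.Bool.Base using (if_then_else_)
open import Data.Fin.Base using (Fin; fromℕ; punchIn; punchOut)
open import Data.Fin.Patterns using (0F; 1F)
open import Data.Fin.Permutation as Perm
  using (Permutation′; _⟨$⟩ʳ_; insert; remove; insert-remove; insert-punchIn)
open import Data.Fin.Properties using (_<?_; _≟_; punchIn-injective)
open import Data.List.Base using (List; [_]; map; foldr; allFin; cartesianProductWith)
import Data.List.Membership.Setoid as Membership
import Data.List.Membership.Setoid.Properties as Membershipₚ
open import Data.List.Membership.Propositional.Properties using (∈-allFin)
open import Data.List.Relation.Unary.Any using (here)
import Data.List.Relation.Unary.All as All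
import Data.List.Relation.Unary.AllPairs as AllPairs
import Data.List.Relation.Unary.Unique.Setoid as Unique
import Data.List.Relation.Unary.Unique.Setoid.Properties as Uniqueₚ
open import Data.List.Relation.Unary.Unique.Propositional.Properties using (allFin⁺)
open import Data.Nat.Base using (ℕ; zero; suc; _!) renaming (_+_ to _+ℕ_)
open import Data.Product.Base using (_×_; _,_; ∃)
open import Data.Vec.Functional using (Vector; _∷_)
open import Level using (Level; _⊔_; 0ℓ) renaming (suc to lsuc)
open import Relation.Binary.Bundles using (Setoid; DecTotalOrder)
open import Relation.Binary.Core using (Rel)
open import Relation.Binary.PropositionalEquality as ≡ using (_≡_)
open import Relation.Binary.Structures using (IsDecTotalOrder)
open import Relation.Nullary.Decidable using (does; yes; no; _×-dec_; dec-yes)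
open import Relation.Nullary.Negation using (¬_)
open import Relation.Unary using (Pred)

-- The real numbers as in classical mathematics: a Dedekind-complete ordered
-- field, which is unique up to isomorphism.
record Reals (c ℓ₁ ℓ₂ : Level) : Set (lsuc (c ⊔ ℓ₁ ⊔ ℓ₂)) where
  infix  8 _⁻¹
  infix  4 _≤_
  field
    commutativeRing : CommutativeRing c ℓ₁

  open CommutativeRing commutativeRing public

  field
    _≤_             : Rel Carrier ℓ₂
    isDecTotalOrder : IsDecTotalOrder _≈_ _≤_
    +-monoˡ-≤       : ∀ {x y} z → x ≤ y → x + z ≤ y + z
    *-nonNeg        : ∀ {x y} → 0# ≤ x → 0# ≤ y → 0# ≤ x * y
    0≉1             : ¬ 0# ≈ 1#
    -- The value of 0# ⁻¹ is unspecified.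
    _⁻¹             : Carrier → Carrier
    ⁻¹-cong         : ∀ {x y} → x ≈ y → x ⁻¹ ≈ y ⁻¹
    ⁻¹-inverseʳ     : ∀ {x} → ¬ x ≈ 0# → x * x ⁻¹ ≈ 1#

  UpperBound : ∀ {p} → Pred Carrier p → Carrier → Set (c ⊔ ℓ₂ ⊔ p)
  UpperBound P u = ∀ {x} → P x → x ≤ u

  field
    supremum : (P : Pred Carrier (c ⊔ ℓ₁ ⊔ ℓ₂)) → ∃ P → ∃ (UpperBound P) →
               ∃ λ s → UpperBound P s × (∀ {u} → UpperBound P u → s ≤ u)

  decTotalOrder : DecTotalOrder c ℓ₁ ℓ₂
  decTotalOrder = record { isDecTotalOrder = isDecTotalOrder }

  open DecTotalOrder decTotalOrder public using (_≤?_; totalOrder)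

-- All permutations of Fin n: one of Fin (suc n) is given by the image of the
-- last point together with a permutation of the remaining n points.  The two
-- lemmas below show that each permutation is listed exactly once.
permutations : ∀ n → List (Permutation′ n)
permutations zero    = [ Perm.id ]
permutations (suc n) =
  cartesianProductWith (insert (fromℕ n)) (allFin (suc n)) (permutations n)

permutationSetoid : ℕ → Setoid 0ℓ 0ℓ
permutationSetoid n = record
  { Carrier       = Permutation′ n
  ; _≈_           = Perm._≈_
  ; isEquivalence = record
    { refl  = λ _ → ≡.refl
    ; sym   = λ e i → ≡.sym (e i)
    ; trans = λ e f i → ≡.trans (e i) (f i)
    }
  }

private
  insert-lookup : ∀ {n} (i j : Fin (suc n)) (π : Permutation′ n) → insert i j π ⟨$⟩ʳ i ≡ j
  insert-lookup i j π with (_ , eq) ← dec-yes (i ≟ i) ≡.refl rewrite eq = ≡.refl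

  insert-cong : ∀ {n} (i : Fin (suc n)) {j k} {π ρ : Permutation′ n} →
                j ≡ k → π Perm.≈ ρ → insert i j π Perm.≈ insert i k ρ
  insert-cong i {j} ≡.refl π≈ρ k with i ≟ k
  ... | yes _   = ≡.refl
  ... | no  i≢k = ≡.cong (punchIn j) (π≈ρ (punchOut i≢k))

  insert-injective : ∀ {n} (i : Fin (suc n)) {j k} {π ρ : Permutation′ n} →
                     insert i j π Perm.≈ insert i k ρ → j ≡ k × π Perm.≈ ρ
  insert-injective i {j} {k} {π} {ρ} e = j≡k , λ l → punchIn-injective k _ _ (begin
    punchIn k (π ⟨$⟩ʳ l)             ≡⟨ ≡.cong (λ h → punchIn h (π ⟨$⟩ʳ l)) j≡k ⟨
    punchIn j (π ⟨$⟩ʳ l)             ≡⟨ insert-punchIn i j π l ⟨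
    insert i j π ⟨$⟩ʳ punchIn i l    ≡⟨ e (punchIn i l) ⟩
    insert i k ρ ⟨$⟩ʳ punchIn i l    ≡⟨ insert-punchIn i k ρ l ⟩
    punchIn k (ρ ⟨$⟩ʳ l)             ∎)
    where
    open ≡.≡-Reasoning
    j≡k : j ≡ k
    j≡k = ≡.trans (≡.sym (insert-lookup i j π)) (≡.trans (e i) (insert-lookup i k ρ))

permutations-complete : ∀ {n} (π : Permutation′ n) →
                        Membership._∈_ (permutationSetoid n) π (permutations n)
permutations-complete {zero}  π = here λ ()
permutations-complete {suc n} π =
  ∈-resp-≈ Sₙ₊₁ {x = insert (fromℕ n) (π ⟨$⟩ʳ fromℕ n) π⁻} {y = π}
    (insert-remove (fromℕ n) π)
    (∈-cartesianProductWith⁺ (≡.setoid (Fin (suc n))) (permutationSetoid n) Sₙ₊₁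
      (λ {_ _ ρ ρ′} → insert-cong (fromℕ n) {π = ρ} {ρ = ρ′})
      {a = π ⟨$⟩ʳ fromℕ n} {b = π⁻}
      (∈-allFin (π ⟨$⟩ʳ fromℕ n)) (permutations-complete π⁻))
  where
  open Membershipₚ
  Sₙ₊₁ = permutationSetoid (suc n)
  π⁻   = remove (fromℕ n) π

permutations-unique : ∀ n → Unique.Unique (permutationSetoid n) (permutations n)
permutations-unique zero    = All.[] AllPairs.∷ AllPairs.[]
permutations-unique (suc n) =
  Uniqueₚ.cartesianProductWith⁺ (≡.setoid (Fin (suc n))) (permutationSetoid n)
    (permutationSetoid (suc n)) (insert (fromℕ n)) (insert-injective (fromℕ n))
    (allFin⁺ (suc n)) (permutations-unique n)

module _ {c ℓ₁ ℓ₂} (ℝ : Reals c ℓ₁ ℓ₂) where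

  open Reals ℝ
  open Min totalOrder using (_⊓_)
  open RawMonoidOps +-rawMonoid using (sum) renaming (_×_ to _·_)
  open RawMonoidOps *-rawMonoid using () renaming (sum to product)

  ofℕ : ℕ → Carrier
  ofℕ n = n · 1#

  infixl 7 _∕_
  _∕_ : ℕ → ℕ → Carrier
  m ∕ n = ofℕ m * ofℕ n ⁻¹

  Simplex : ∀ {k} → Vector Carrier k → Set (ℓ₁ ⊔ ℓ₂)
  Simplex x = (∀ i → 0# ≤ x i) × sum x ≈ 1#

  F : Carrier → Carrier
  F z = ((11 ∕ 6) * z) ⊓ 1#

  F′ : Carrier → Carrier
  F′ z = if does ((0# ≤? z) ×-dec (z ≤? 6 ∕ 11)) then 11 ∕ 6 else 0#

  -- The product of 1 - F (x i) over those i with σ(i) < σ(j).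
  survival : ∀ {k} → Vector Carrier k → Permutation′ k → Fin k → Carrier
  survival x σ j =
    product λ i → if does (σ ⟨$⟩ʳ i <? σ ⟨$⟩ʳ j) then 1# - F (x i) else 1#

  -- The function d_k for k = 2 + n; the distinguished coordinates x₁ and x₂
  -- have indices 0 and 1.
  d : ∀ {n} → Vector Carrier (2 +ℕ n) → Carrier
  d {n} x = 1 ∕ ((2 +ℕ n) !) * foldr _+_ 0# (map term (permutations (2 +ℕ n)))
    where
    term : Permutation′ (2 +ℕ n) → Carrier
    term σ = F′ (x 0F) * survival x σ 0F
           + F′ (x 1F) * survival x σ 1F

  record IsMaximumOn {a p} {A : Set a} (P : Pred A p) (f : A → Carrier)
                     (m : Carrier) : Set (a ⊔ p ⊔ ℓ₁ ⊔ ℓ₂) where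
    field
      attained : ∃ λ a → P a × f a ≈ m
      bound    : ∀ a → P a → f a ≤ m

  -- IsD n x₁ x₂ m says that D_k(x₁, x₂) = m, where k = 2 + n.
  IsD : ℕ → Carrier → Carrier → Carrier → Set (c ⊔ ℓ₁ ⊔ ℓ₂)
  IsD n x₁ x₂ = IsMaximumOn {A = Vector Carrier n}
    (λ xs → Simplex (x₁ ∷ x₂ ∷ xs)) (λ xs → d (x₁ ∷ x₂ ∷ xs))

{-# OPTIONS --safe #-}

-- Append a zero coordinate to a maximiser for k.  Since F(0) = 0, the new
-- coordinate contributes the factor 1 to every product, and deleting it from a
-- permutation of k+1 points does not change the order of the remaining ones.
-- Each permutation of k points arises k+1 times, which the normalisation
-- 1/(k+1)! compensates, so d takes the same value at the longer vector.
module Submission where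

open import Defs
open import Algebra.Bundles using (CommutativeMonoid)
import Algebra.Construct.NaturalChoice.Min as Min
import Algebra.Definitions.RawMonoid as RawMonoidOps
import Algebra.Properties.CommutativeMonoid.Sum as SumProperties
import Algebra.Properties.Monoid.Mult as MonoidMult
import Algebra.Properties.Ring as RingProperties
import Algebra.Properties.Semiring.Mult as SemiringMult
open import Data.Bool.Base using (Bool; true; false; if_then_else_)
open import Data.Fin.Base using (Fin; zero; suc; fromℕ; punchIn; _<_)
open import Data.Fin.Patterns using (0F; 1F)
open import Data.Fin.Permutation using (Permutation′; _⟨$⟩ʳ_; insert; insert-punchIn)
open import Data.Fin.Properties using (_<?_; punchIn-mono-≤; punchIn-cancel-≤)
open import Data.List.Base using (List; []; _∷_; _++_; map; foldr; length; allFin; cartesianProductWith)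
open import Data.List.Properties using (length-tabulate; map-++; map-∘)
open import Data.Nat.Base using (ℕ; zero; suc; _!; NonZero) renaming (_+_ to _+ℕ_; _*_ to _*ℕ_)
import Data.Nat.Properties as ℕ
open import Data.Product.Base using (_,_)
open import Data.Sum.Base using (inj₁; inj₂)
open import Data.Vec.Functional as Vector using (Vector; removeAt; insertAt)
open import Data.Vec.Functional.Properties using (insertAt-lookup; removeAt-insertAt)
open import Function.Base using (_∘_; id)
open import Function.Bundles using (_⇔_; mk⇔)
open import Relation.Binary.Bundles using (DecTotalOrder)
open import Relation.Binary.PropositionalEquality as ≡ using (_≡_; _≗_)
import Relation.Binary.Reasoning.Setoid as SetoidReasoning
open import Relation.Nullary.Decidable using (does; does-⇔)
open import Relation.Nullary.Negation using (¬_)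

punchIn-<-⇔ : ∀ {n} (i : Fin (suc n)) (j k : Fin n) → (punchIn i j < punchIn i k) ⇔ (j < k)
punchIn-<-⇔ i j k = mk⇔
  (λ p → ℕ.≰⇒> (ℕ.<⇒≱ p ∘ punchIn-mono-≤ i k j))
  (λ p → ℕ.≰⇒> (ℕ.<⇒≱ p ∘ punchIn-cancel-≤ i k j))

insert-<? : ∀ {n} (i j : Fin (suc n)) (π : Permutation′ n) (a b : Fin n) →
            does (insert i j π ⟨$⟩ʳ punchIn i a <? insert i j π ⟨$⟩ʳ punchIn i b) ≡
            does (π ⟨$⟩ʳ a <? π ⟨$⟩ʳ b)
insert-<? i j π a b
  rewrite insert-punchIn i j π a | insert-punchIn i j π b
  = does-⇔ (punchIn-<-⇔ j (π ⟨$⟩ʳ a) (π ⟨$⟩ʳ b)) (_ <? _) (_ <? _)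

module _ {c ℓ} (M : CommutativeMonoid c ℓ) where
  open CommutativeMonoid M
  open MonoidMult monoid using (×-congˡ) renaming (_×_ to _·_)
  open SetoidReasoning setoid

  private
    Σ : List Carrier → Carrier
    Σ = foldr _∙_ ε

  foldr-++-∙ : ∀ xs ys → Σ (xs ++ ys) ≈ Σ xs ∙ Σ ys
  foldr-++-∙ []       ys = sym (identityˡ (Σ ys))
  foldr-++-∙ (x ∷ xs) ys = trans (∙-congˡ (foldr-++-∙ xs ys)) (sym (assoc x (Σ xs) (Σ ys)))

  foldr-map-cong : ∀ {a} {A : Set a} {g h : A → Carrier} → (∀ z → g z ≈ h z) →
                   ∀ zs → Σ (map g zs) ≈ Σ (map h zs)
  foldr-map-cong g≈h []       = refl
  foldr-map-cong g≈h (z ∷ zs) = ∙-cong (g≈h z) (foldr-map-cong g≈h zs)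

  foldr-cartesianProductWith :
    ∀ {a b d} {A : Set a} {B : Set b} {D : Set d} (f : A → B → D)
    (g : D → Carrier) (h : B → Carrier) → (∀ x y → g (f x y) ≈ h y) →
    ∀ xs ys → Σ (map g (cartesianProductWith f xs ys)) ≈ length xs · Σ (map h ys)
  foldr-cartesianProductWith f g h e []       ys = refl
  foldr-cartesianProductWith f g h e (x ∷ xs) ys = begin
    Σ (map g (map (f x) ys ++ rest))          ≡⟨ ≡.cong Σ (map-++ g (map (f x) ys) rest) ⟩
    Σ (map g (map (f x) ys) ++ map g rest)    ≈⟨ foldr-++-∙ (map g (map (f x) ys)) (map g rest) ⟩
    Σ (map g (map (f x) ys)) ∙ Σ (map g rest) ≡⟨ ≡.cong (λ l → Σ l ∙ Σ (map g rest)) (map-∘ ys) ⟨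
    Σ (map (g ∘ f x) ys) ∙ Σ (map g rest)     ≈⟨ ∙-cong (foldr-map-cong (e x) ys)
                                                        (foldr-cartesianProductWith f g h e xs ys) ⟩
    Σ (map h ys) ∙ length xs · Σ (map h ys)   ∎
    where rest = cartesianProductWith f xs ys

  foldr-permutations :
    ∀ n (g : Permutation′ (suc n) → Carrier) (h : Permutation′ n → Carrier) →
    (∀ j π → g (insert (fromℕ n) j π) ≈ h π) →
    Σ (map g (permutations (suc n))) ≈ suc n · Σ (map h (permutations n))
  foldr-permutations n g h e = trans
    (foldr-cartesianProductWith (insert (fromℕ n)) g h e (allFin (suc n)) (permutations n))
    (×-congˡ (length-tabulate {n = suc n} id))

module _ {c ℓ₁ ℓ₂} (ℝ : Reals c ℓ₁ ℓ₂) where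
  open Reals ℝ hiding (zero)
  open DecTotalOrder decTotalOrder using (total; antisym; ≤-respʳ-≈; ≤-respˡ-≈)
    renaming (refl to ≤-refl; trans to ≤-trans)
  open Min totalOrder using (⊓-congʳ; x≤y⇒x⊓y≈x)
  open RingProperties ring using (-0#≈0#; -1*x≈-x; -‿involutive)
  open RawMonoidOps +-rawMonoid using (sum)
  open RawMonoidOps *-rawMonoid using () renaming (sum to product)
  open SemiringMult semiring using (×1-homo-*; ×-assoc-*; ×-congʳ) renaming (_×_ to _·_)
  open SumProperties *-commutativeMonoid using ()
    renaming (sum-remove to product-remove; sum-cong-≗ to product-cong-≗)
  open SumProperties +-commutativeMonoid using (sum-remove; sum-cong-≗)
  open SetoidReasoning setoid

  0≤1 : 0# ≤ 1#
  0≤1 with total 0# 1#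
  ... | inj₁ 0≤1 = 0≤1
  ... | inj₂ 1≤0 = ≤-respʳ-≈ (trans (-1*x≈-x (- 1#)) (-‿involutive 1#)) (*-nonNeg 0≤-1 0≤-1)
    where
    0≤-1 : 0# ≤ - 1#
    0≤-1 = ≤-respˡ-≈ (-‿inverseʳ 1#) (≤-respʳ-≈ (+-identityˡ (- 1#)) (+-monoˡ-≤ (- 1#) 1≤0))

  1≤1+x : ∀ {x} → 0# ≤ x → 1# ≤ 1# + x
  1≤1+x {x} 0≤x = ≤-respˡ-≈ (+-identityˡ 1#) (≤-respʳ-≈ (+-comm x 1#) (+-monoˡ-≤ 1# 0≤x))

  0≤ofℕ : ∀ n → 0# ≤ ofℕ ℝ n
  0≤ofℕ zero    = ≤-refl
  0≤ofℕ (suc n) = ≤-trans 0≤1 (1≤1+x (0≤ofℕ n))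

  ofℕ≉0 : ∀ n .{{_ : NonZero n}} → ¬ ofℕ ℝ n ≈ 0#
  ofℕ≉0 (suc n) e = 0≉1 (antisym 0≤1 (≤-respʳ-≈ e (1≤1+x (0≤ofℕ n))))

  ofℕ-⁻¹-*-cancel : ∀ m n .{{_ : NonZero m}} .{{_ : NonZero n}} →
                    ofℕ ℝ (m *ℕ n) ⁻¹ * ofℕ ℝ m ≈ ofℕ ℝ n ⁻¹
  ofℕ-⁻¹-*-cancel m n {{_}} {{n≢0}} = begin
    r * a                 ≈⟨ *-identityʳ (r * a) ⟨
    r * a * 1#            ≈⟨ *-congˡ (⁻¹-inverseʳ (ofℕ≉0 n)) ⟨
    r * a * (b * b ⁻¹)    ≈⟨ *-assoc (r * a) b (b ⁻¹) ⟨
    r * a * b * b ⁻¹      ≈⟨ *-congʳ (*-assoc r a b) ⟩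
    r * (a * b) * b ⁻¹    ≈⟨ *-congʳ (*-congˡ (×1-homo-* m n)) ⟨
    r * ab * b ⁻¹         ≈⟨ *-congʳ (*-comm r ab) ⟩
    ab * r * b ⁻¹         ≈⟨ *-congʳ (⁻¹-inverseʳ (ofℕ≉0 (m *ℕ n) {{ℕ.m*n≢0 m n}})) ⟩
    1# * b ⁻¹             ≈⟨ *-identityˡ (b ⁻¹) ⟩
    b ⁻¹                  ∎
    where
    a  = ofℕ ℝ m
    b  = ofℕ ℝ n
    ab = ofℕ ℝ (m *ℕ n)
    r  = ab ⁻¹

  ∕!-suc : ∀ m n x → _∕_ ℝ m (suc n !) * (suc n · x) ≈ _∕_ ℝ m (n !) * x
  ∕!-suc m n x = begin
    u * r * (suc n · x)              ≈⟨ *-congˡ (×-congʳ (suc n) (*-identityˡ x)) ⟨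
    u * r * (suc n · (1# * x))       ≈⟨ *-congˡ (×-assoc-* (suc n) 1# x) ⟨
    u * r * (ofℕ ℝ (suc n) * x)      ≈⟨ *-assoc (u * r) (ofℕ ℝ (suc n)) x ⟨
    u * r * ofℕ ℝ (suc n) * x        ≈⟨ *-congʳ (*-assoc u r (ofℕ ℝ (suc n))) ⟩
    u * (r * ofℕ ℝ (suc n)) * x      ≈⟨ *-congʳ (*-congˡ (ofℕ-⁻¹-*-cancel (suc n) (n !) {{_}} {{n ℕ.!≢0}})) ⟩
    u * ofℕ ℝ (n !) ⁻¹ * x           ∎
    where
    u = ofℕ ℝ m
    r = ofℕ ℝ (suc n !) ⁻¹

  1-F0≈1 : ∀ {z} → z ≈ 0# → 1# - F ℝ z ≈ 1#
  1-F0≈1 {z} z≈0 = begin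
    1# - F ℝ z   ≈⟨ +-congˡ (-‿cong Fz≈0) ⟩
    1# - 0#      ≈⟨ +-congˡ -0#≈0# ⟩
    1# + 0#      ≈⟨ +-identityʳ 1# ⟩
    1#           ∎
    where
    11z/6≈0 : _∕_ ℝ 11 6 * z ≈ 0#
    11z/6≈0 = trans (*-congˡ z≈0) (zeroʳ (_∕_ ℝ 11 6))

    Fz≈0 : F ℝ z ≈ 0#
    Fz≈0 = trans (⊓-congʳ 1# 11z/6≈0) (x≤y⇒x⊓y≈x 0≤1)

  if-≈ : ∀ (b : Bool) {x y z} → x ≈ z → y ≈ z → (if b then x else y) ≈ z
  if-≈ true  x≈z y≈z = x≈z
  if-≈ false x≈z y≈z = y≈z

  survival-insert : ∀ {k} (x : Vector Carrier (suc k)) {y : Vector Carrier k} (i : Fin (suc k)) →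
                    x i ≈ 0# → removeAt x i ≗ y → ∀ j π a →
                    survival ℝ x (insert i j π) (punchIn i a) ≈ survival ℝ y π a
  survival-insert {k} x {y} i xᵢ≈0 x≗y j π a = begin
    product t                      ≈⟨ product-remove {i = i} t ⟩
    t i * product (removeAt t i)   ≈⟨ *-congʳ (if-≈ (does (σ ⟨$⟩ʳ i <? σ ⟨$⟩ʳ punchIn i a))
                                                    (1-F0≈1 xᵢ≈0) refl) ⟩
    1# * product (removeAt t i)    ≈⟨ *-identityˡ (product (removeAt t i)) ⟩
    product (removeAt t i)         ≡⟨ product-cong-≗ {x = removeAt t i} (λ l →
                                        ≡.cong₂ (λ b z → if b then 1# - F ℝ z else 1#)
                                                (insert-<? i j π l a) (x≗y l)) ⟩
    survival ℝ y π a               ∎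
    where
    σ = insert i j π

    t : Vector Carrier (suc k)
    t l = if does (σ ⟨$⟩ʳ l <? σ ⟨$⟩ʳ punchIn i a) then 1# - F ℝ (x l) else 1#

  d-removeAt : ∀ {n} (x : Vector Carrier (3 +ℕ n)) {y : Vector Carrier (2 +ℕ n)} →
               x (fromℕ (2 +ℕ n)) ≈ 0# → removeAt x (fromℕ (2 +ℕ n)) ≗ y →
               d ℝ x ≈ d ℝ y
  d-removeAt {n} x xₖ≈0 x≗y = trans
    (*-congˡ (foldr-permutations +-commutativeMonoid (2 +ℕ n) _ _ λ j π → +-cong
      (*-cong (reflexive (≡.cong (F′ ℝ) (x≗y 0F))) (survival-insert x last xₖ≈0 x≗y j π 0F))
      (*-cong (reflexive (≡.cong (F′ ℝ) (x≗y 1F))) (survival-insert x last xₖ≈0 x≗y j π 1F))))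
    (∕!-suc 1 (2 +ℕ n) _)
    where last = fromℕ (2 +ℕ n)

  insertAt-Simplex : ∀ {k} {x : Vector Carrier k} i → Simplex ℝ x → Simplex ℝ (insertAt x i 0#)
  insertAt-Simplex {k} {x} i (x≥0 , Σx≈1) = nonNeg i x≥0 , (begin
    sum x⁺                       ≈⟨ sum-remove {i = i} x⁺ ⟩
    x⁺ i + sum (removeAt x⁺ i)   ≡⟨ ≡.cong₂ _+_ (insertAt-lookup x i 0#)
                                      (sum-cong-≗ (removeAt-insertAt x i 0#)) ⟩
    0# + sum x                   ≈⟨ +-identityˡ (sum x) ⟩
    sum x                        ≈⟨ Σx≈1 ⟩
    1#                           ∎)
    where
    x⁺ = insertAt x i 0#

    nonNeg : ∀ {k} {x : Vector Carrier k} i → (∀ l → 0# ≤ x l) → ∀ l → 0# ≤ insertAt x i 0# l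
    nonNeg         zero    x≥0 zero    = ≤-refl
    nonNeg         zero    x≥0 (suc l) = x≥0 l
    nonNeg {suc _} (suc i) x≥0 zero    = x≥0 zero
    nonNeg {suc _} (suc i) x≥0 (suc l) = nonNeg i (x≥0 ∘ suc) l

  Simplex-cong : ∀ {k} {x y : Vector Carrier k} → x ≗ y → Simplex ℝ x → Simplex ℝ y
  Simplex-cong {x = x} x≗y (x≥0 , Σx≈1) =
    (λ i → ≡.subst (0# ≤_) (x≗y i) (x≥0 i)) ,
    trans (reflexive (≡.sym (sum-cong-≗ {x = x} x≗y))) Σx≈1

insertAt-∷-∷ : ∀ {a n} {A : Set a} (x y z : A) (xs : Vector A n) (i : Fin (suc n)) →
               insertAt (x Vector.∷ y Vector.∷ xs) (suc (suc i)) z ≗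
               x Vector.∷ y Vector.∷ insertAt xs i z
insertAt-∷-∷ x y z xs i zero          = ≡.refl
insertAt-∷-∷ x y z xs i (suc zero)    = ≡.refl
insertAt-∷-∷ x y z xs i (suc (suc l)) = ≡.refl

lemma6p3 : ∀ {c ℓ₁ ℓ₂} (ℝ : Reals c ℓ₁ ℓ₂) → let open Reals ℝ in
    ∀ (n : ℕ) (x₁ x₂ : Carrier) → 0# ≤ x₁ → 0# ≤ x₂ → x₁ + x₂ ≤ 1# →
    (n ≡ 0 → x₁ + x₂ ≈ 1#) →
    ∀ {Dₖ Dₖ₊₁} → IsD ℝ n x₁ x₂ Dₖ → IsD ℝ (suc n) x₁ x₂ Dₖ₊₁ → Dₖ ≤ Dₖ₊₁
lemma6p3 ℝ n x₁ x₂ _ _ _ _ isDₖ isDₖ₊₁ =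
  let xs , x∈Δ , dx≈Dₖ = IsMaximumOn.attained isDₖ
      last = fromℕ (2 +ℕ n)
      x    = x₁ Vector.∷ x₂ Vector.∷ xs
      xs⁺  = insertAt xs (fromℕ n) 0#
      x⁺≗  = insertAt-∷-∷ x₁ x₂ 0# xs (fromℕ n)
      dx⁺≈dx = d-removeAt ℝ (x₁ Vector.∷ x₂ Vector.∷ xs⁺)
        (reflexive (insertAt-lookup xs (fromℕ n) 0#))
        (λ l → ≡.trans (≡.sym (x⁺≗ (punchIn last l))) (removeAt-insertAt x last 0# l))
  in ≤-respˡ-≈ (trans dx⁺≈dx dx≈Dₖ)
       (IsMaximumOn.bound isDₖ₊₁ xs⁺ (Simplex-cong ℝ x⁺≗ (insertAt-Simplex ℝ last x∈Δ)))
  where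
  open Reals ℝ
  open DecTotalOrder decTotalOrder using (≤-respˡ-≈)
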